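{- There is an infinite word $\mathbf{w}$ over the ternary alphabet $\{0,1,2\}$ such that $\mathbf{w}$ is overlap-free and its curling-number transform $C(\mathbf{w})$ is $(7/3)^+$-free.
   Context: Words are indexed from $0$; infinite words are one-sided, $\mathbf{w} = \mathbf{w}[0]\mathbf{w}[1]\cdots$; $x[i..j]$ denotes the factor (contiguous block) $x[i]\cdots x[j]$. A finite word $x$ of length $n \ge 1$ has period $p$, $1\le p\le n$, if $x[i]=x[i+p]$ for all $0\le i<n-p$; its exponent is $n/p$ where $p$ is its least period. A finite or infinite word is $\alpha^+$-free if it has no nonempty finite factor of exponent strictly greater than $\alpha$. An overlap is a word of the form $a x a x a$ with $a$ a single letter and $x$ a possibly empty word; a word is overlap-free if it contains no overlap as a factor (equivalently, it is $2^+$-free). The curling number of a nonempty finite word $u$ is the largest integer $k \ge 1$ such that $u = y z^k$ for some (possibly empty) word $y$ and some nonempty word $z$. For a finite or infinite word $x$, the curling-number transform $C(x)$ is the word over the positive integers, of the same length as $x$, whose $i$-th letter $C(x)[i]$ is the curling number of the prefix $x[0..i]$. -}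

module Defs where

open import Data.Nat using (ℕ; suc; _+_; _≤_; NonZero)
open import Data.Nat.Properties using (≤-antisym)
open import Data.Fin using (Fin; toℕ)
open import Data.Integer using (+_)
open import Data.Rational as ℚ using (ℚ)
open import Data.List using (List; []; _∷_; _++_; length; lookup; applyUpTo; replicate; concat)
open import Data.Product using (Σ-syntax; ∃-syntax; _×_)
open import Relation.Binary.PropositionalEquality using (_≡_; _≢_)
open import Relation.Nullary using (¬_)

-- Finite words are lists.
InfiniteWord : Set → Set
InfiniteWord A = ℕ → A

private
  variable
    A : Set

factor : InfiniteWord A → (start len : ℕ) → List A
factor w i n = applyUpTo (λ k → w (i + k)) n

_FactorOf_ : List A → InfiniteWord A → Set
u FactorOf w = ∃[ i ] u ≡ factor w i (length u)

-- A valid pair of positions i, j = i + p is the same thing as an i < length u ∸ p.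
record HasPeriod (u : List A) (p : ℕ) : Set where
  field
    positive : 1 ≤ p
    bounded  : p ≤ length u
    periodic : (i j : Fin (length u)) → toℕ j ≡ toℕ i + p → lookup u i ≡ lookup u j

record IsLeastPeriod (u : List A) (p : ℕ) : Set where
  field
    hasPeriod : HasPeriod u p
    least     : ∀ {q} → HasPeriod u q → p ≤ q

-- The empty word has no period, hence no exponent; every nonempty word over an
-- alphabet with decidable equality has exactly one, since its length is a period.
HasExponent : List A → ℚ → Set
HasExponent u e =
  ∃[ p ] Σ[ nz ∈ NonZero p ] IsLeastPeriod u p × e ≡ ((+ length u) ℚ./ p) {{nz}}

_⁺-Free_ : ℚ → InfiniteWord A → Set
α ⁺-Free w = ∀ {u e} → u FactorOf w → HasExponent u e → ¬ (α ℚ.< e)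

IsOverlap : List A → Set
IsOverlap {A} u = Σ[ a ∈ A ] ∃[ x ] u ≡ (a ∷ x) ++ (a ∷ x) ++ (a ∷ [])

OverlapFree : InfiniteWord A → Set
OverlapFree w = ∀ {u} → u FactorOf w → ¬ IsOverlap u

_^_ : List A → ℕ → List A
z ^ k = concat (replicate k z)

EndsInPower : List A → ℕ → Set
EndsInPower u k = ∃[ y ] ∃[ z ] z ≢ [] × u ≡ y ++ (z ^ k)

record IsCurlingNumber (u : List A) (k : ℕ) : Set where
  field
    positive : 1 ≤ k
    attained : EndsInPower u k
    greatest : ∀ {m} → EndsInPower u m → m ≤ k

curlingNumber-unique : {u : List A} {k l : ℕ} →
                       IsCurlingNumber u k → IsCurlingNumber u l → k ≡ l
curlingNumber-unique p q = ≤-antisym (greatest q (attained p)) (greatest p (attained q))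
  where open IsCurlingNumber

-- `IsCurlingTransform w c` says c = C(w); by `curlingNumber-unique` this
-- determines every letter of c.
IsCurlingTransform : InfiniteWord A → InfiniteWord ℕ → Set
IsCurlingTransform w c = ∀ i → IsCurlingNumber (factor w 0 (suc i)) (c i)

{-# OPTIONS --safe #-}
module Submission where

-- Apply 22-uniform morphisms g and h to a ternary square-free word s (the fixed
-- point of Leech's 13-uniform morphism), and take w = g(s), c = h(s). Blocks are
-- synchronised: for b ≠ c, g(a) occurs in g(b)g(c) only at a border; and one cut
-- position splits every block so that either part determines the letter. Hence a
-- square in g(s) of period at least twice the block length comes from a square
-- in s, and there is none; the same holds for h(s), and for s itself by
-- infinite descent. Shorter repetitions lie in the image of a square-free word
-- of five letters, so there are finitely many cases. They show that g(s) has no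
-- overlap, that a square ends exactly where h(s) has a 2, and that no
-- repetition in h(s) has exponent above 7/3.

open import Defs
open import Data.Nat using (ℕ; zero; suc; _+_; _*_; _∸_; _≤_; _<_; NonZero; z≤n; s≤s; s≤s⁻¹; _/_; _%_; _≤?_; _<?_; _≟_)
import Data.Nat.Properties as ℕ
open import Data.Nat.DivMod using (_mod_; m≡m%n+[m/n]*n; m%n<n; [m+kn]%n≡m%n; m<n⇒m%n≡m; m<n⇒m/n≡0; m*n/n≡m; 0/n≡0; m/n≤m; m/n<m; /-monoˡ-≤; m<n*o⇒m/o<n; +-distrib-/-∣ʳ)
open import Data.Nat.Divisibility using (n∣m*n)
open import Data.Nat.Induction using (<-rec)
open import Data.Nat.Tactic.RingSolver using (solve-∀)
open import Data.Fin using (Fin; zero; suc; toℕ; fromℕ<)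
open import Data.Fin.Patterns using (0F; 1F; 2F)
import Data.Fin.Properties as Finₚ
open import Data.Integer using (+_)
import Data.Integer as ℤ
import Data.Integer.Properties as ℤₚ
import Data.Rational as ℚ
import Data.Rational.Properties as ℚₚ
import Data.Rational.Unnormalised as ℚᵘ
import Data.Rational.Unnormalised.Properties as ℚᵘₚ
open import Data.List using (List; []; _∷_; _++_; length; take; drop; applyUpTo; upTo; concatMap)
import Data.List.Properties as Listₚ
import Data.List.Relation.Unary.All as All
open import Data.List.Membership.Propositional.Properties using (∈-upTo⁺; ∈-upTo⁻)
open import Data.Vec using (Vec; []; _∷_; lookup; toList)
open import Data.Product using (Σ-syntax; ∃-syntax; _×_; _,_; proj₁; proj₂)
open import Data.Sum using (_⊎_; inj₁; inj₂)
open import Data.Empty using (⊥; ⊥-elim)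
open import Function using (_∘_)
open import Relation.Nullary using (¬_; Dec; yes; no; contradiction)
open import Relation.Nullary.Decidable using (map′; toWitness; ¬?; _→-dec_; _×-dec_; _⊎-dec_)
open import Relation.Unary using (Decidable)
open import Relation.Binary.Definitions using (DecidableEquality)
open import Relation.Binary.PropositionalEquality using (_≡_; _≢_; refl; sym; trans; cong; cong₂; subst; subst₂; module ≡-Reasoning)

-- Slices of lists

private
  variable
    A B : Set

slice : (o n : ℕ) → List A → List A
slice o n u = take n (drop o u)

applyUpTo-cong : ∀ {f g : ℕ → A} n → (∀ {t} → t < n → f t ≡ g t) → applyUpTo f n ≡ applyUpTo g n
applyUpTo-cong zero    eq = refl
applyUpTo-cong (suc n) eq = cong₂ _∷_ (eq (s≤s z≤n)) (applyUpTo-cong n (λ t<n → eq (s≤s t<n)))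

slice-applyUpTo : ∀ (f : ℕ → A) o {n m} → o + n ≤ m →
                  slice o n (applyUpTo f m) ≡ applyUpTo (λ k → f (o + k)) n
slice-applyUpTo f zero    {zero}  _         = refl
slice-applyUpTo f zero    {suc n} (s≤s n≤m) = cong (f 0 ∷_) (slice-applyUpTo (f ∘ suc) zero n≤m)
slice-applyUpTo f (suc o) {n}     (s≤s n≤m) = slice-applyUpTo (f ∘ suc) o n≤m

applyUpTo-++ : ∀ (f : ℕ → A) m n → applyUpTo f (m + n) ≡ applyUpTo f m ++ applyUpTo (λ k → f (m + k)) n
applyUpTo-++ f zero    n = refl
applyUpTo-++ f (suc m) n = cong (f 0 ∷_) (applyUpTo-++ (f ∘ suc) m n)

applyUpTo-toList : ∀ {n} (v : Vec A n) (f : ℕ → A) → (∀ k → f (toℕ k) ≡ lookup v k) →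
                   applyUpTo f n ≡ toList v
applyUpTo-toList []      f eq = refl
applyUpTo-toList (x ∷ v) f eq = cong₂ _∷_ (eq zero) (applyUpTo-toList v (f ∘ suc) (eq ∘ suc))

-- Factors and repetitions of an infinite word

module _ (w : InfiniteWord A) where

  length-factor : ∀ i n → length (factor w i n) ≡ n
  length-factor i n = Listₚ.length-applyUpTo (λ k → w (i + k)) n

  slice-factor : ∀ i o {n m} → o + n ≤ m → slice o n (factor w i m) ≡ factor w (i + o) n
  slice-factor i o {n} le = trans (slice-applyUpTo _ o le)
    (applyUpTo-cong n λ {t} _ → cong w (sym (ℕ.+-assoc i o t)))

  factor-++ : ∀ i m n → factor w i (m + n) ≡ factor w i m ++ factor w (i + m) n
  factor-++ i m n = trans (applyUpTo-++ _ m n)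
    (cong (factor w i m ++_) (applyUpTo-cong n λ {t} _ → cong w (sym (ℕ.+-assoc i m t))))

  -- Here `n` counts only the compared letters, so the repetition covers `p + n` of them: `n = p` is
  -- a square, `n = p + 1` an overlap. A record, unlike a bare equation, lets `i`, `p` and `n` be
  -- recovered by unification.
  record Repeats (i p n : ℕ) : Set where
    constructor repeats
    field agree : factor w i n ≡ factor w (i + p) n

  SquareFree : Set
  SquareFree = ∀ i p → ¬ Repeats i (suc p) (suc p)

  repeats-sub : ∀ {i p n} o {m} → o + m ≤ n → Repeats i p n → Repeats (i + o) p m
  repeats-sub {i} {p} {n} o {m} le (repeats rep) = repeats (begin
    factor w (i + o) m                ≡⟨ slice-factor i o le ⟨
    slice o m (factor w i n)          ≡⟨ cong (slice o m) rep ⟩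
    slice o m (factor w (i + p) n)    ≡⟨ slice-factor (i + p) o le ⟩
    factor w (i + p + o) m            ≡⟨ cong (λ k → factor w k m) (swap i p o) ⟩
    factor w (i + o + p) m            ∎)
    where
    open ≡-Reasoning
    swap : ∀ i p o → i + p + o ≡ i + o + p
    swap = solve-∀

  repeats⇒slices : ∀ {b o p n N X} → factor w b N ≡ X → o + p + n ≤ N → Repeats (b + o) p n →
                   slice o n X ≡ slice (o + p) n X
  repeats⇒slices {b} {o} {p} {n} {N} refl le (repeats rep) = begin
    slice o n (factor w b N)        ≡⟨ slice-factor b o (ℕ.≤-trans (ℕ.+-monoˡ-≤ n (ℕ.m≤m+n o p)) le) ⟩
    factor w (b + o) n              ≡⟨ rep ⟩
    factor w (b + o + p) n          ≡⟨ cong (λ k → factor w k n) (ℕ.+-assoc b o p) ⟩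
    factor w (b + (o + p)) n        ≡⟨ slice-factor b (o + p) le ⟨
    slice (o + p) n (factor w b N)  ∎
    where open ≡-Reasoning

  slices⇒repeats : ∀ {b o p n N X} → factor w b N ≡ X → o + p + n ≤ N →
                   slice o n X ≡ slice (o + p) n X → Repeats (b + o) p n
  slices⇒repeats {b} {o} {p} {n} {N} refl le eq = repeats (begin
    factor w (b + o) n              ≡⟨ slice-factor b o (ℕ.≤-trans (ℕ.+-monoˡ-≤ n (ℕ.m≤m+n o p)) le) ⟨
    slice o n (factor w b N)        ≡⟨ eq ⟩
    slice (o + p) n (factor w b N)  ≡⟨ slice-factor b (o + p) le ⟩
    factor w (b + (o + p)) n        ≡⟨ cong (λ k → factor w k n) (ℕ.+-assoc b o p) ⟨
    factor w (b + o + p) n          ∎)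
    where open ≡-Reasoning

slice-++ : ∀ (y v {z} : List A) → slice (length y) (length v) (y ++ v ++ z) ≡ v
slice-++ []      []      = refl
slice-++ []      (x ∷ v) = cong (x ∷_) (slice-++ [] v)
slice-++ (_ ∷ y) v       = slice-++ y v

repeats-cong : ∀ {v w : InfiniteWord A} → (∀ n → v n ≡ w n) → ∀ {i p n} → Repeats v i p n → Repeats w i p n
repeats-cong eq {i} {p} {n} (repeats rep) = repeats (trans (sym (applyUpTo-cong n λ {t} _ → eq (i + t)))
  (trans rep (applyUpTo-cong n λ {t} _ → eq (i + p + t))))

squareFree⇒alternates : ∀ {w : InfiniteWord A} → SquareFree w → ∀ j → w j ≢ w (suc j)
squareFree⇒alternates {w = w} sf j eq = sf j 0 (repeats (cong (_∷ [])
  (trans (cong w (ℕ.+-identityʳ j)) (trans eq (cong w (lemma j))))))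
  where
  lemma : ∀ j → suc j ≡ j + 1 + 0
  lemma = solve-∀

-- Periods, powers and overlaps as repetitions

module _ (w : InfiniteWord A) where

  factor-infix : ∀ {i n} y v {z} → factor w i n ≡ y ++ v ++ z → factor w (i + length y) (length v) ≡ v
  factor-infix {i} {n} y v {z} eq = begin
    factor w (i + length y) (length v)        ≡⟨ slice-factor w i (length y) fits ⟨
    slice (length y) (length v) (factor w i n) ≡⟨ cong (slice (length y) (length v)) eq ⟩
    slice (length y) (length v) (y ++ v ++ z) ≡⟨ slice-++ y v ⟩
    v                                         ∎
    where
    open ≡-Reasoning
    fits : length y + length v ≤ n
    fits = ℕ.≤-trans (ℕ.+-monoʳ-≤ (length y) (Listₚ.length-++-≤ˡ v))
      (ℕ.≤-reflexive (trans (sym (Listₚ.length-++ y)) (trans (cong length (sym eq)) (length-factor w i n))))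

  -- Two factorisations of one factor show `v` at positions `length z` apart. Overlaps, squares and
  -- higher powers are turned into repetitions by rebracketing a single factorisation.
  factor-shift : ∀ {i n} y z v {x₁ x₂} → factor w i n ≡ y ++ v ++ x₁ → factor w i n ≡ (y ++ z) ++ v ++ x₂ →
                 Repeats w (i + length y) (length z) (length v)
  factor-shift {i} y z v eq₁ eq₂ = repeats (trans (factor-infix y v eq₁)
    (trans (sym (factor-infix (y ++ z) v eq₂))
      (cong (λ b → factor w b (length v))
        (trans (cong (λ t → i + t) (Listₚ.length-++ y)) (sym (ℕ.+-assoc i (length y) (length z)))))))

  hasPeriod⇒repeats : ∀ i n {u p} → u ≡ factor w i n → HasPeriod u p → ∃[ m ] p + m ≡ n × Repeats w i p m
  hasPeriod⇒repeats i n {p = p} refl period = m , p+m≡n , repeats (applyUpTo-cong m agree)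
    where
    open HasPeriod period
    p≤n = subst (p ≤_) (length-factor w i n) bounded
    m = proj₁ (ℕ.m≤n⇒∃[o]m+o≡n p≤n)
    p+m≡n : p + m ≡ n
    p+m≡n = proj₂ (ℕ.m≤n⇒∃[o]m+o≡n p≤n)
    agree : ∀ {t} → t < m → w (i + t) ≡ w (i + p + t)
    agree {t} t<m = begin
      w (i + t)                            ≡⟨ cong (λ k → w (i + k)) (Finₚ.toℕ-fromℕ< t<) ⟨
      w (i + toℕ (fromℕ< t<))              ≡⟨ Listₚ.lookup-applyUpTo _ n (fromℕ< t<) ⟨
      Data.List.lookup (factor w i n) (fromℕ< t<) ≡⟨ periodic _ _ (trans (Finₚ.toℕ-fromℕ< p+t<)
                                                  (trans (ℕ.+-comm p t) (cong (_+ p) (sym (Finₚ.toℕ-fromℕ< t<))))) ⟩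
      Data.List.lookup (factor w i n) (fromℕ< p+t<) ≡⟨ Listₚ.lookup-applyUpTo _ n (fromℕ< p+t<) ⟩
      w (i + toℕ (fromℕ< p+t<))            ≡⟨ cong (λ k → w (i + k)) (Finₚ.toℕ-fromℕ< p+t<) ⟩
      w (i + (p + t))                      ≡⟨ cong w (ℕ.+-assoc i p t) ⟨
      w (i + p + t)                        ∎
      where
      open ≡-Reasoning
      p+t< : p + t < length (factor w i n)
      p+t< = subst (p + t <_) (trans p+m≡n (sym (length-factor w i n))) (ℕ.+-monoʳ-< p t<m)
      t< : t < length (factor w i n)
      t< = ℕ.≤-<-trans (ℕ.m≤n+m t p) p+t<

  square⇒endsInPower : ∀ {i p} → Repeats w i (suc p) (suc p) → EndsInPower (factor w 0 (i + suc p + suc p)) 2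
  square⇒endsInPower {i} {p} (repeats rep) = factor w 0 i , z , (λ ()) , (begin
    factor w 0 (i + suc p + suc p)                     ≡⟨ factor-++ w 0 (i + suc p) (suc p) ⟩
    factor w 0 (i + suc p) ++ factor w (i + suc p) (suc p) ≡⟨ cong₂ _++_ (factor-++ w 0 i (suc p)) (sym rep) ⟩
    (factor w 0 i ++ z) ++ z                           ≡⟨ Listₚ.++-assoc (factor w 0 i) z z ⟩
    factor w 0 i ++ z ++ z                             ≡⟨ cong (λ u → factor w 0 i ++ z ++ u) (Listₚ.++-identityʳ z) ⟨
    factor w 0 i ++ (z ^ 2)                              ∎)
    where
    open ≡-Reasoning
    z = factor w i (suc p)

overlap⇒repeats : ∀ {w : InfiniteWord A} {i u} → u ≡ factor w i (length u) → IsOverlap u →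
                  ∃[ p ] Repeats w i (suc p) (suc (suc p))
overlap⇒repeats {w = w} {i} {u} u-factor (a , x , u≡) = length x ,
  -- With `z = a ∷ x` the overlap is z z a, and z a is both its prefix and its suffix, `length z`
  -- apart.
  subst₂ (λ b n → Repeats w b (suc (length x)) n) (ℕ.+-identityʳ i)
    (trans (Listₚ.length-++ z) (ℕ.+-comm (length z) 1))
    (factor-shift w [] z (z ++ a ∷ [])
      (trans (sym u-factor) (trans u≡ (sym (Listₚ.++-assoc z (a ∷ []) (x ++ a ∷ [])))))
      (trans (sym u-factor) (trans u≡ (cong (z ++_) (sym (Listₚ.++-identityʳ (z ++ a ∷ [])))))))
  where z = a ∷ x

-- Images under uniform morphisms

module _ {L} .{{_ : NonZero L}} (g : B → Vec A L) where

  image : InfiniteWord B → InfiniteWord A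
  image s n = lookup (g (s (n / L))) (n mod L)

  imageList : List B → List A
  imageList = concatMap (toList ∘ g)

  image-lookup : ∀ s j (k : Fin L) → image s (j * L + toℕ k) ≡ lookup (g (s j)) k
  image-lookup s j k = cong₂ (λ m → lookup (g (s m))) quotient
    (Finₚ.toℕ-injective (trans (Finₚ.toℕ-fromℕ< _) remainder))
    where
    open ≡-Reasoning
    quotient : (j * L + toℕ k) / L ≡ j
    quotient = begin
      (j * L + toℕ k) / L      ≡⟨ cong (_/ L) (ℕ.+-comm (j * L) (toℕ k)) ⟩
      (toℕ k + j * L) / L      ≡⟨ +-distrib-/-∣ʳ (toℕ k) (n∣m*n j) ⟩
      toℕ k / L + j * L / L    ≡⟨ cong₂ _+_ (m<n⇒m/n≡0 (Finₚ.toℕ<n k)) (m*n/n≡m j L) ⟩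
      j                        ∎
    remainder : (j * L + toℕ k) % L ≡ toℕ k
    remainder = begin
      (j * L + toℕ k) % L      ≡⟨ cong (_% L) (ℕ.+-comm (j * L) (toℕ k)) ⟩
      (toℕ k + j * L) % L      ≡⟨ [m+kn]%n≡m%n (toℕ k) j L ⟩
      toℕ k % L                ≡⟨ m<n⇒m%n≡m (Finₚ.toℕ<n k) ⟩
      toℕ k                    ∎

  factor-block : ∀ s j → factor (image s) (j * L) L ≡ toList (g (s j))
  factor-block s j = applyUpTo-toList (g (s j)) _ (image-lookup s j)

  factor-blocks : ∀ s j m → factor (image s) (j * L) (m * L) ≡ imageList (factor s j m)
  factor-blocks s j zero    = refl
  factor-blocks s j (suc m) = begin
    factor (image s) (j * L) (L + m * L)
      ≡⟨ factor-++ (image s) (j * L) L (m * L) ⟩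
    factor (image s) (j * L) L ++ factor (image s) (j * L + L) (m * L)
      ≡⟨ cong₂ _++_ (factor-block s j) (cong (λ k → factor (image s) k (m * L)) (ℕ.+-comm (j * L) L)) ⟩
    toList (g (s j)) ++ factor (image s) (suc j * L) (m * L)
      ≡⟨ cong (toList (g (s j)) ++_) (factor-blocks s (suc j) m) ⟩
    toList (g (s j)) ++ imageList (factor s (suc j) m)
      ≡⟨ cong₂ (λ x u → toList (g x) ++ imageList u) (cong s (sym (ℕ.+-identityʳ j)))
           (applyUpTo-cong m λ {t} _ → cong s (sym (ℕ.+-suc j t))) ⟩
    imageList (factor s j (suc m)) ∎
    where open ≡-Reasoning

module _ {L} .{{_ : NonZero L}} where

  index-split : ∀ i → i ≡ i / L * L + i % L
  index-split i = trans (m≡m%n+[m/n]*n i L) (ℕ.+-comm (i % L) (i / L * L))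

module _ {L} .{{_ : NonZero L}} (g : B → Vec A L) (s : InfiniteWord B) where

  -- Makes short repetitions a finite matter: one that starts in block `i / L` and ends within `m`
  -- blocks is visible in the image of an `m`-letter factor of `s`.
  window : ∀ {i p n} m → i % L + p + n ≤ m * L → Repeats (image g s) i p n →
           slice (i % L) n (imageList g (factor s (i / L) m)) ≡ slice (i % L + p) n (imageList g (factor s (i / L) m))
  window {i} {p} {n} m le rep = repeats⇒slices (image g s) (factor-blocks g s (i / L) m) le
    (subst (λ b → Repeats (image g s) b p n) (index-split i) rep)

-- Fixed points of prolongable morphisms

module FixedPoint {L} .{{_ : NonZero L}} (g : B → Vec B L) (1<L : 1 < L)
                  {b} (g-prolongable : lookup (g b) (0 mod L) ≡ b) where

  -- Starting from a constant word keeps every stage infinite. The letters at positions up to `k`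
  -- are final from stage `k` on.
  iterates : ℕ → InfiniteWord B
  iterates zero    _ = b
  iterates (suc k)   = image g (iterates k)

  -- Letter `n` of an image comes from letter `n / L`, which is strictly earlier for positive `n`
  -- because `1 < L`. Prolongability settles position 0.
  iterates-suc : ∀ k {n} → n ≤ k → iterates (suc k) n ≡ iterates k n
  iterates-suc zero    z≤n  = g-prolongable
  iterates-suc (suc k) {n} n≤1+k = cong (λ x → lookup (g x) (n mod L)) (iterates-suc k (quotient≤ n n≤1+k))
    where
    quotient≤ : ∀ n → n ≤ suc k → n / L ≤ k
    quotient≤ zero    _     = ℕ.≤-trans (ℕ.≤-reflexive (0/n≡0 L)) z≤n
    quotient≤ (suc n) 1+n≤1+k = s≤s⁻¹ (ℕ.≤-trans (m/n<m (suc n) L 1<L) 1+n≤1+k)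

  iterates-stable : ∀ d n → iterates (d + n) n ≡ iterates n n
  iterates-stable zero    n = refl
  iterates-stable (suc d) n = trans (iterates-suc (d + n) (ℕ.m≤n+m n d)) (iterates-stable d n)

  fixedPoint : InfiniteWord B
  fixedPoint n = iterates n n

  fixedPoint-fixed : ∀ n → fixedPoint n ≡ image g fixedPoint n
  fixedPoint-fixed n = trans (sym (iterates-suc n ℕ.≤-refl))
    (cong (λ x → lookup (g x) (n mod L))
      (subst (λ m → iterates m (n / L) ≡ fixedPoint (n / L)) (ℕ.m∸n+n≡m (m/n≤m n L))
        (iterates-stable (n ∸ n / L) (n / L))))

-- Desubstitution of repetitions

module _ {h k} .{{_ : NonZero (h + k)}} where

  private
    L : ℕ
    L = h + k

  -- Each block is cut into its first `h` and last `k` letters. In `sync` the letters `y` and `z`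
  -- are distinct, as neighbours in a square-free word are.
  record Decodable (g : B → Vec A L) : Set where
    field
      prefix : ∀ x y → slice 0 h (toList (g x)) ≡ slice 0 h (toList (g y)) → x ≡ y
      suffix : ∀ x y → slice h k (toList (g x)) ≡ slice h k (toList (g y)) → x ≡ y
      sync   : ∀ x y z → y ≢ z → ∀ {o} → o < L → 1 ≤ o →
               slice o L (imageList g (y ∷ z ∷ [])) ≢ toList (g x)

  module _ {g : B → Vec A L} (decodable : Decodable g) where
    open Decodable decodable
    open Repeats

    slice-block : ∀ s j o {n} → o + n ≤ L →
                  slice o n (toList (g (s j))) ≡ factor (image g s) (j * L + o) n
    slice-block s j o {n} le =
      trans (cong (slice o n) (sym (factor-block g s j))) (slice-factor (image g s) (j * L) o le)

    module _ {s : InfiniteWord B} (s-alternates : ∀ j → s j ≢ s (suc j)) where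

      -- The copy of block `j` lies in two neighbouring blocks, whose letters differ; `sync` rules
      -- out every offset but 0, so the copy is itself a block.
      block-shift : ∀ j p → Repeats (image g s) (j * L) p L → ∃[ q ] p ≡ q * L
      block-shift j p rep = aligned ((j * L + p) % L) refl
        where
        open ≡-Reasoning
        i = j * L + p
        m = i / L
        aligned : ∀ o → i % L ≡ o → ∃[ q ] p ≡ q * L
        aligned zero eq = q , ℕ.+-cancelˡ-≡ (j * L) p (q * L) (begin
          j * L + p         ≡⟨ i≡m*L ⟩
          m * L             ≡⟨ cong (_* L) m≡j+q ⟨
          (j + q) * L       ≡⟨ ℕ.*-distribʳ-+ L j q ⟩
          j * L + q * L     ∎)
          where
          i≡m*L : i ≡ m * L
          i≡m*L = trans (m≡m%n+[m/n]*n i L) (cong (_+ m * L) eq)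
          j≤m : j ≤ m
          j≤m = ℕ.*-cancelʳ-≤ j m L (ℕ.≤-trans (ℕ.m≤m+n (j * L) p) (ℕ.≤-reflexive i≡m*L))
          q = proj₁ (ℕ.m≤n⇒∃[o]m+o≡n j≤m)
          m≡j+q = proj₂ (ℕ.m≤n⇒∃[o]m+o≡n j≤m)
        aligned (suc o) eq = contradiction
          (begin
            slice (suc o) L (imageList g (s m ∷ s (suc m) ∷ []))
              ≡⟨ cong₂ (λ a b → slice (suc o) L (imageList g (s a ∷ s b ∷ [])))
                   (sym (ℕ.+-identityʳ m)) (sym (ℕ.+-comm m 1)) ⟩
            slice (suc o) L (imageList g (factor s m 2))
              ≡⟨ cong (slice (suc o) L) (factor-blocks g s m 2) ⟨
            slice (suc o) L (factor (image g s) (m * L) (2 * L))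
              ≡⟨ slice-factor (image g s) (m * L) (suc o)
                   (ℕ.+-mono-≤ (ℕ.<⇒≤ o<L) (ℕ.≤-reflexive (sym (ℕ.+-identityʳ L)))) ⟩
            factor (image g s) (m * L + suc o) L
              ≡⟨ cong (λ b → factor (image g s) b L) i≡m*L+o ⟨
            factor (image g s) i L
              ≡⟨ agree rep ⟨
            factor (image g s) (j * L) L
              ≡⟨ factor-block g s j ⟩
            toList (g (s j)) ∎)
          (sync (s j) (s m) (s (suc m)) (s-alternates m) o<L (s≤s z≤n))
          where
          o<L : suc o < L
          o<L = subst (_< L) eq (m%n<n i L)
          i≡m*L+o : i ≡ m * L + suc o
          i≡m*L+o = trans (m≡m%n+[m/n]*n i L) (trans (cong (_+ m * L) eq) (ℕ.+-comm (suc o) (m * L)))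

      -- If the repetition starts at offset r ≤ h of its block, then it contains the
      -- suffixes of length k of that block and its successors; if h ≤ r, it contains
      -- the prefixes of length h of the successors, one more block at the far end.
      desubstitute : ∀ {i p n} → p ≤ n → 2 * L ≤ n → Repeats (image g s) i p n →
                     ∃[ q ] ∃[ j ] p ≡ q * L × Repeats s j q q
      desubstitute {i} {p} {n} p≤n 2L≤n rep = conclude
        where
        a = i / L
        r = i % L
        r≤L : r ≤ L
        r≤L = ℕ.<⇒≤ (m%n<n i L)
        d = proj₁ (ℕ.m≤n⇒∃[o]m+o≡n r≤L)
        r+d≡L : r + d ≡ L
        r+d≡L = proj₂ (ℕ.m≤n⇒∃[o]m+o≡n r≤L)
        d≤L : d ≤ L
        d≤L = subst (d ≤_) r+d≡L (ℕ.m≤n+m d r)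

        -- The start of block `suc a + u`. The trailing `+ 0` is the offset passed to
        -- `slices-agree`, and writing `L` as `r + d` makes the identity polynomial.
        i+d : ∀ u → i + (d + u * L) ≡ (suc a + u) * L + 0
        i+d u = trans (cong (_+ (d + u * L)) (m≡m%n+[m/n]*n i L))
          (subst (λ l → r + a * l + (d + u * l) ≡ (suc a + u) * l + 0) r+d≡L (lemma r a d u))
          where
          lemma : ∀ r a d u → r + a * (r + d) + (d + u * (r + d)) ≡ (suc a + u) * (r + d) + 0
          lemma = solve-∀

        -- The cut of block `a + u`; `e` letters lead from the start of the repetition to the first
        -- cut.
        i+e : ∀ e → r + e ≡ h → ∀ u → i + (e + u * L) ≡ (a + u) * L + h
        i+e e r+e≡h u = trans (cong (_+ (e + u * L)) (m≡m%n+[m/n]*n i L))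
          (subst (λ l → r + a * L + (e + u * L) ≡ (a + u) * L + l) r+e≡h (lemma r a e u L))
          where
          lemma : ∀ r a e u l → r + a * l + (e + u * l) ≡ (a + u) * l + (r + e)
          lemma = solve-∀

        -- Block `suc a` begins after at most `L` letters, and `2 * L ≤ n` leaves it wholly inside
        -- the compared part.
        shift : ∃[ q ] p ≡ q * L
        shift = block-shift (suc a) p (subst (λ b → Repeats (image g s) b p L)
          (trans (cong (λ t → i + t) (sym (ℕ.+-identityʳ d)))
            (trans (i+d 0) (trans (ℕ.+-identityʳ _) (cong (_* L) (ℕ.+-identityʳ (suc a))))))
          (repeats-sub (image g s) d
            (ℕ.≤-trans (ℕ.+-mono-≤ d≤L (ℕ.≤-reflexive (sym (ℕ.+-identityʳ L)))) 2L≤n) rep))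
        q = proj₁ shift
        p≡q*L = proj₂ shift

        block-end≤n : ∀ {c l u} → u < q → c + l ≤ L → (c + u * L) + l ≤ n
        block-end≤n {c} {l} {u} u<q c+l≤L = begin
          c + u * L + l    ≡⟨ swap c (u * L) l ⟩
          c + l + u * L    ≤⟨ ℕ.+-monoˡ-≤ (u * L) c+l≤L ⟩
          suc u * L        ≤⟨ ℕ.*-monoˡ-≤ L u<q ⟩
          q * L            ≡⟨ p≡q*L ⟨
          p                ≤⟨ p≤n ⟩
          n                ∎
          where
          open ℕ.≤-Reasoning
          swap : ∀ c m l → c + m + l ≡ c + l + m
          swap = solve-∀

        shift-blocks : ∀ j o → j * L + o + p ≡ (j + q) * L + o
        shift-blocks j o = trans (cong (λ t → j * L + o + t) p≡q*L) (lemma j o q L)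
          where
          lemma : ∀ j o q l → j * l + o + q * l ≡ (j + q) * l + o
          lemma = solve-∀

        slices-agree : ∀ j o {l} → o + l ≤ L → Repeats (image g s) (j * L + o) p l →
                       slice o l (toList (g (s j))) ≡ slice o l (toList (g (s (j + q))))
        slices-agree j o {l} le rep′ = trans (slice-block s j o le) (trans (agree rep′)
          (trans (cong (λ b → factor (image g s) b l) (shift-blocks j o))
            (sym (slice-block s (j + q) o le))))

        swap : ∀ j u → j + u + q ≡ j + q + u
        swap j u = lemma j u q
          where
          lemma : ∀ j u q → j + u + q ≡ j + q + u
          lemma = solve-∀

        repeats-letters : ∀ j → (∀ {u} → u < q → s (j + u) ≡ s (j + u + q)) → Repeats s j q q
        repeats-letters j eq = repeats (applyUpTo-cong q λ {u} u<q → trans (eq u<q) (cong s (swap j u)))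

        by-suffixes : r ≤ h → Repeats s a q q
        by-suffixes r≤h = repeats-letters a λ {u} u<q →
          suffix _ _ (slices-agree (a + u) h ℕ.≤-refl
            (subst (λ b → Repeats (image g s) b p k) (i+e e r+e≡h u)
              (repeats-sub (image g s) (e + u * L)
                (block-end≤n {e} u<q (ℕ.+-monoˡ-≤ k (subst (e ≤_) r+e≡h (ℕ.m≤n+m e r)))) rep)))
          where
          e = proj₁ (ℕ.m≤n⇒∃[o]m+o≡n r≤h)
          r+e≡h = proj₂ (ℕ.m≤n⇒∃[o]m+o≡n r≤h)

        by-prefixes : h ≤ r → Repeats s (suc a) q q
        by-prefixes h≤r = repeats-letters (suc a) λ {u} u<q →
          prefix _ _ (slices-agree (suc a + u) 0 (ℕ.m≤m+n h k)
            (subst (λ b → Repeats (image g s) b p h) (i+d u)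
              (repeats-sub (image g s) (d + u * L)
                (block-end≤n {d} u<q (ℕ.≤-trans (ℕ.+-monoʳ-≤ d h≤r)
                  (ℕ.≤-reflexive (trans (ℕ.+-comm d r) r+d≡L)))) rep)))

        conclude : ∃[ q ] ∃[ j ] p ≡ q * L × Repeats s j q q
        conclude with ℕ.≤-total r h
        ... | inj₁ r≤h = q , a , p≡q*L , by-suffixes r≤h
        ... | inj₂ h≤r = q , suc a , p≡q*L , by-prefixes h≤r

module _ {h k} .{{_ : NonZero (h + k)}} {g : B → Vec A (h + k)} (decodable : Decodable {h = h} g)
         {s : InfiniteWord B} (s-squareFree : SquareFree s) where

  no-long-square : ∀ {i p n} → suc p ≤ n → 2 * (h + k) ≤ n → ¬ Repeats (image g s) i (suc p) n
  no-long-square p<n 2L≤n rep with desubstitute decodable {s = s} (squareFree⇒alternates s-squareFree) p<n 2L≤n rep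
  -- The case `q = 0` is absurd, as the period is `suc p`.
  ... | suc q , j , _ , square = s-squareFree j q square

-- The three morphisms

leech : Fin 3 → Vec (Fin 3) 13
leech 0F = 0F ∷ 1F ∷ 2F ∷ 1F ∷ 0F ∷ 2F ∷ 1F ∷ 2F ∷ 0F ∷ 1F ∷ 2F ∷ 1F ∷ 0F ∷ []
leech 1F = 1F ∷ 2F ∷ 0F ∷ 2F ∷ 1F ∷ 0F ∷ 2F ∷ 0F ∷ 1F ∷ 2F ∷ 0F ∷ 2F ∷ 1F ∷ []
leech 2F = 2F ∷ 0F ∷ 1F ∷ 0F ∷ 2F ∷ 1F ∷ 0F ∷ 1F ∷ 2F ∷ 0F ∷ 1F ∷ 0F ∷ 2F ∷ []

-- Found by computer search. Every square in the image of a square-free word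
-- ends where a square inside the same block ends, so the curling numbers of a
-- block do not depend on what precedes it, and curlingMorphism lists them.
wordMorphism : Fin 3 → Vec (Fin 3) 22
wordMorphism 0F = 0F ∷ 0F ∷ 1F ∷ 0F ∷ 1F ∷ 1F ∷ 0F ∷ 1F ∷ 0F ∷ 2F ∷ 0F ∷ 0F ∷ 2F ∷ 0F ∷ 2F ∷ 1F ∷ 1F ∷ 0F ∷ 1F ∷ 0F ∷ 0F ∷ 2F ∷ []
wordMorphism 1F = 0F ∷ 0F ∷ 1F ∷ 0F ∷ 1F ∷ 1F ∷ 0F ∷ 1F ∷ 0F ∷ 2F ∷ 0F ∷ 0F ∷ 2F ∷ 0F ∷ 2F ∷ 1F ∷ 0F ∷ 0F ∷ 2F ∷ 0F ∷ 2F ∷ 2F ∷ []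
wordMorphism 2F = 0F ∷ 0F ∷ 1F ∷ 0F ∷ 1F ∷ 1F ∷ 0F ∷ 1F ∷ 0F ∷ 2F ∷ 0F ∷ 0F ∷ 1F ∷ 0F ∷ 0F ∷ 1F ∷ 2F ∷ 0F ∷ 0F ∷ 1F ∷ 2F ∷ 2F ∷ []

curlingMorphism : Fin 3 → Vec ℕ 22
curlingMorphism 0F = 1 ∷ 2 ∷ 1 ∷ 1 ∷ 2 ∷ 2 ∷ 1 ∷ 2 ∷ 2 ∷ 1 ∷ 1 ∷ 2 ∷ 1 ∷ 2 ∷ 2 ∷ 1 ∷ 2 ∷ 1 ∷ 1 ∷ 2 ∷ 2 ∷ 1 ∷ []
curlingMorphism 1F = 1 ∷ 2 ∷ 1 ∷ 1 ∷ 2 ∷ 2 ∷ 1 ∷ 2 ∷ 2 ∷ 1 ∷ 1 ∷ 2 ∷ 1 ∷ 2 ∷ 2 ∷ 1 ∷ 1 ∷ 2 ∷ 1 ∷ 1 ∷ 2 ∷ 2 ∷ []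
curlingMorphism 2F = 1 ∷ 2 ∷ 1 ∷ 1 ∷ 2 ∷ 2 ∷ 1 ∷ 2 ∷ 2 ∷ 1 ∷ 1 ∷ 2 ∷ 1 ∷ 1 ∷ 2 ∷ 2 ∷ 1 ∷ 1 ∷ 2 ∷ 1 ∷ 2 ∷ 2 ∷ []

-- Finite checks

below? : ∀ {P : ℕ → Set} → Decidable P → ∀ n → Dec (∀ {m} → m < n → P m)
below? P? n = map′ (λ all m<n → All.lookup all (∈-upTo⁺ m<n)) (λ f → All.tabulate (f ∘ ∈-upTo⁻)) (All.all? P? (upTo n))

decidable : ∀ h {k} .{{_ : NonZero (h + k)}} → DecidableEquality A → (g : Fin 3 → Vec A (h + k)) →
            Dec (Decodable {h = h} g)
decidable h {k} _≟A_ g = map′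
  (λ (p , s , y) → record { prefix = p ; suffix = s ; sync = y })
  (λ d → let open Decodable d in prefix , suffix , sync)
  ((Finₚ.all? λ x → Finₚ.all? λ y → (slice 0 h (toList (g x)) ≟L slice 0 h (toList (g y))) →-dec (x Finₚ.≟ y))
   ×-dec (Finₚ.all? λ x → Finₚ.all? λ y → (slice h k (toList (g x)) ≟L slice h k (toList (g y))) →-dec (x Finₚ.≟ y))
   ×-dec (Finₚ.all? λ x → Finₚ.all? λ y → Finₚ.all? λ z → ¬? (y Finₚ.≟ z) →-dec
      below? (λ o → (1 ≤? o) →-dec ¬? (slice o (h + k) (imageList g (y ∷ z ∷ [])) ≟L toList (g x))) (h + k)))
  where _≟L_ = Listₚ.≡-dec _≟A_

-- Periods are written suc p. The bound N keeps slices from being truncated at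
-- the end of u, where they could agree for lack of letters.
NoRepeats : (len : ℕ → ℕ) (N m n : ℕ) → List A → Set
NoRepeats len N m n u = ∀ {o} → o < m → ∀ {p} → p < n → o + suc p + len p ≤ N →
                        slice o (len p) u ≢ slice (o + suc p) (len p) u

noRepeats? : DecidableEquality A → ∀ len N m n → Decidable {A = List A} (NoRepeats len N m n)
noRepeats? _≟A_ len N m n u = below? (λ o → below? (λ p → (o + suc p + len p ≤? N) →-dec
  ¬? (Listₚ.≡-dec _≟A_ (slice o (len p) u) (slice (o + suc p) (len p) u))) n) m

-- Five letters have room for squares of period 1 and 2 only. Five is also the number of blocks that
-- the windows below require.
SquareFreeWord : List (Fin 3) → Set
SquareFreeWord = NoRepeats suc 5 5 2

squareFreeWord? : Decidable SquareFreeWord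
squareFreeWord? = noRepeats? Finₚ._≟_ suc 5 5 2

squareFreeWords? : ∀ {P : List (Fin 3) → Set} → Decidable P →
                   Dec (∀ u → length u ≡ 5 → SquareFreeWord u → P u)
squareFreeWords? P? = map′
  (λ { f (a ∷ b ∷ c ∷ d ∷ e ∷ []) refl → f a b c d e })
  (λ f a b c d e → f (a ∷ b ∷ c ∷ d ∷ e ∷ []) refl)
  (Finₚ.all? λ a → Finₚ.all? λ b → Finₚ.all? λ c → Finₚ.all? λ d → Finₚ.all? λ e →
    let u = a ∷ b ∷ c ∷ d ∷ e ∷ [] in squareFreeWord? u →-dec P? u)

-- The least integer above 4(p + 1)/3: an exponent above 7/3 at period p + 1
-- leaves more than 4/3 of a period after the first one.
excess : ℕ → ℕ
excess p = suc (4 * suc p / 3)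

-- The position `o + (p + suc p)` is the last one of the square. It stays within 21 + 43 + 43
-- letters, inside the 110 of five blocks, so no slice is truncated there.
TwoAtSquareEnds : List (Fin 3) → List ℕ → Set
TwoAtSquareEnds u v = ∀ {o} → o < 22 → ∀ {p} → p < 43 →
  slice o (suc p) u ≡ slice (o + suc p) (suc p) u → slice (o + (p + suc p)) 1 v ≡ 2 ∷ []

twoAtSquareEnds? : ∀ u v → Dec (TwoAtSquareEnds u v)
twoAtSquareEnds? u v = below? (λ o → below? (λ p →
  Listₚ.≡-dec Finₚ._≟_ (slice o (suc p) u) (slice (o + suc p) (suc p) u) →-dec
  Listₚ.≡-dec _≟_ (slice (o + (p + suc p)) 1 v) (2 ∷ [])) 43) 22

SquareEndsAt : ∀ {L} → Vec A L → ℕ → Set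
SquareEndsAt {L = L} v r = ∃[ o ] ∃[ p ] suc r ≡ toℕ {L} o + suc (toℕ {L} p) + suc (toℕ p) ×
  slice (toℕ o) (suc (toℕ p)) (toList v) ≡ slice (toℕ o + suc (toℕ p)) (suc (toℕ p)) (toList v)

squareEndsAt? : DecidableEquality A → ∀ {L} (v : Vec A L) r → Dec (SquareEndsAt v r)
squareEndsAt? _≟A_ v r = Finₚ.any? λ o → Finₚ.any? λ p →
  (suc r ≟ toℕ o + suc (toℕ p) + suc (toℕ p)) ×-dec
  Listₚ.≡-dec _≟A_ (slice (toℕ o) (suc (toℕ p)) (toList v)) (slice (toℕ o + suc (toℕ p)) (suc (toℕ p)) (toList v))

-- Abstract, since unfolding these proofs runs the whole decision procedure.
abstract
  leech-decodable : Decodable {h = 1} leech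
  leech-decodable = toWitness {a? = decidable 1 Finₚ._≟_ leech} _

  -- The blocks of 0 and 1 agree in 16 letters and differ in the next, so 17 is the earliest
  -- possible cut; the same holds for `curlingMorphism`.
  wordMorphism-decodable : Decodable {h = 17} wordMorphism
  wordMorphism-decodable = toWitness {a? = decidable 17 Finₚ._≟_ wordMorphism} _

  curlingMorphism-decodable : Decodable {h = 17} curlingMorphism
  curlingMorphism-decodable = toWitness {a? = decidable 17 _≟_ curlingMorphism} _

  leech-block-pair : ∀ x y → let u = imageList leech (x ∷ y ∷ []) in
                     ∀ {o} → o < 13 → slice o 1 u ≡ slice (o + 1) 1 u → o ≡ 12 × x ≡ y
  leech-block-pair = toWitness {a? = Finₚ.all? λ x → Finₚ.all? λ y → let u = imageList leech (x ∷ y ∷ []) in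
    below? (λ o → (Listₚ.≡-dec Finₚ._≟_ (slice o 1 u) (slice (o + 1) 1 u)) →-dec ((o ≟ 12) ×-dec (x Finₚ.≟ y))) 13} _

  -- Five consecutive letters meet at most two blocks. Hence alternation alone makes the five-letter
  -- factors of a fixed point square-free, which the descent needs before square-freeness is known.
  leech-squareFreeWord : ∀ x y → x ≢ y → ∀ {o} → o < 13 →
                         SquareFreeWord (slice o 5 (imageList leech (x ∷ y ∷ [])))
  leech-squareFreeWord = toWitness {a? = Finₚ.all? λ x → Finₚ.all? λ y → ¬? (x Finₚ.≟ y) →-dec
    below? (λ o → squareFreeWord? (slice o 5 (imageList leech (x ∷ y ∷ [])))) 13} _

  -- Periods up to 25 are checked, and `desubstitute` takes over at 26 = 2 * 13. A square of period
  -- 25 at offset 12 ends after 62 of the 65 letters.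
  leech-short : ∀ u → length u ≡ 5 → SquareFreeWord u → NoRepeats suc 65 13 25 (imageList leech u)
  leech-short = toWitness {a? = squareFreeWords? (noRepeats? Finₚ._≟_ suc 65 13 25 ∘ imageList leech)} _

  word-short : ∀ u → length u ≡ 5 → SquareFreeWord u →
               NoRepeats (λ p → suc (suc p)) 110 22 43 (imageList wordMorphism u)
  word-short = toWitness
    {a? = squareFreeWords? (noRepeats? Finₚ._≟_ (λ p → suc (suc p)) 110 22 43 ∘ imageList wordMorphism)} _

  -- `excess` is 43 at period 32 and 45 at period 33, where it passes 2 * 22 = 44 and
  -- `no-long-square` takes over.
  curling-short : ∀ u → length u ≡ 5 → SquareFreeWord u →
                  NoRepeats excess 110 22 32 (imageList curlingMorphism u)
  curling-short = toWitness
    {a? = squareFreeWords? (noRepeats? _≟_ excess 110 22 32 ∘ imageList curlingMorphism)} _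

  word-squares : ∀ u → length u ≡ 5 → SquareFreeWord u →
                 TwoAtSquareEnds (imageList wordMorphism u) (imageList curlingMorphism u)
  word-squares = toWitness
    {a? = squareFreeWords? (λ u → twoAtSquareEnds? (imageList wordMorphism u) (imageList curlingMorphism u))} _

  -- Gives the lower bound on the curling numbers, while `word-squares` serves the upper bound.
  curling-letter : ∀ x r → lookup (curlingMorphism x) r ≡ 1 ⊎
                           lookup (curlingMorphism x) r ≡ 2 × SquareEndsAt (wordMorphism x) (toℕ r)
  curling-letter = toWitness {a? = Finₚ.all? λ x → Finₚ.all? λ r →
    (lookup (curlingMorphism x) r ≟ 1) ⊎-dec
    ((lookup (curlingMorphism x) r ≟ 2) ×-dec squareEndsAt? Finₚ._≟_ (wordMorphism x) (toℕ r))} _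

-- Square-freeness of fixed points of Leech's morphism

squareFree⇒word : ∀ {s} → SquareFree s → ∀ j → SquareFreeWord (factor s j 5)
squareFree⇒word {s} sf j _ _ le eq = sf _ _ (slices⇒repeats s {b = j} refl le eq)

%13≤12 : ∀ n → n % 13 ≤ 12
%13≤12 n = s≤s⁻¹ (m%n<n n 13)

module _ {s : InfiniteWord (Fin 3)} (s-fixed : ∀ n → s n ≡ image leech s n) where

  -- Equal neighbours s n and s (n + 1) lie on both sides of a block border, and
  -- then the letters of the two blocks are equal as well.
  leechFixed-alternates : ∀ n → s n ≢ s (suc n)
  leechFixed-alternates = <-rec _ λ n rec eq →
    -- The indices `+ 0` and `+ 1` are those to which `factor s (n / 13) 2` computes.
    let o≡12 , x≡y = leech-block-pair (s (n / 13 + 0)) (s (n / 13 + 1)) (m%n<n n 13)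
          (window leech s 2 (ℕ.≤-trans (ℕ.+-monoˡ-≤ 1 (ℕ.+-monoˡ-≤ 1 (%13≤12 n))) (ℕ.m≤m+n 14 12))
            (repeats-cong s-fixed (pair n eq)))
    in rec (n/13<n n o≡12) (trans (cong s (sym (ℕ.+-identityʳ (n / 13)))) (trans x≡y (cong s (ℕ.+-comm (n / 13) 1))))
    where
    pair : ∀ n → s n ≡ s (suc n) → Repeats s n 1 1
    pair n eq = repeats (cong (_∷ []) (trans (cong s (ℕ.+-identityʳ n))
      (trans eq (cong s (trans (ℕ.+-comm 1 n) (sym (ℕ.+-identityʳ (n + 1))))))))
    -- The remainder 12 excludes `n = 0`, where the quotient would not be smaller.
    n/13<n : ∀ n → n % 13 ≡ 12 → n / 13 < n
    n/13<n (suc n) _ = m/n<m (suc n) 13 (ℕ.m≤m+n 2 11)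

  leechFixed-words : ∀ i → SquareFreeWord (factor s i 5)
  leechFixed-words i = subst SquareFreeWord word
    (leech-squareFreeWord (s j) (s (suc j)) (leechFixed-alternates j) (m%n<n i 13))
    where
    open ≡-Reasoning
    j = i / 13
    o = i % 13
    word : slice o 5 (imageList leech (s j ∷ s (suc j) ∷ [])) ≡ factor s i 5
    word = begin
      slice o 5 (imageList leech (s j ∷ s (suc j) ∷ []))
        ≡⟨ cong₂ (λ a b → slice o 5 (imageList leech (s a ∷ s b ∷ []))) (sym (ℕ.+-identityʳ j)) (ℕ.+-comm 1 j) ⟩
      slice o 5 (imageList leech (factor s j 2))
        ≡⟨ cong (slice o 5) (factor-blocks leech s j 2) ⟨
      slice o 5 (factor (image leech s) (j * 13) 26)
        ≡⟨ slice-factor (image leech s) (j * 13) o (ℕ.≤-trans (ℕ.+-monoˡ-≤ 5 (%13≤12 i)) (ℕ.m≤m+n 17 9)) ⟩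
      factor (image leech s) (j * 13 + o) 5
        ≡⟨ cong (λ b → factor (image leech s) b 5) (index-split i) ⟨
      factor (image leech s) i 5
        ≡⟨ applyUpTo-cong 5 (λ {t} _ → sym (s-fixed (i + t))) ⟩
      factor s i 5 ∎

  -- Descent on the period: a square beyond the finite check comes from one of a thirteenth of its
  -- period, elsewhere in `s`, so the induction generalises over the start.
  leechFixed-squareFree : SquareFree s
  leechFixed-squareFree i p = <-rec (λ p → ∀ i → ¬ Repeats s i (suc p) (suc p)) step p i
    where
    step : ∀ p → (∀ {q} → q < p → ∀ i → ¬ Repeats s i (suc q) (suc q)) → ∀ i → ¬ Repeats s i (suc p) (suc p)
    step p rec i rep with p <? 25
    ... | yes p<25 = leech-short (factor s (i / 13) 5) refl (leechFixed-words (i / 13)) (m%n<n i 13) p<25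
      fits (window leech s 5 fits (repeats-cong s-fixed rep))
      where
      fits : i % 13 + suc p + suc p ≤ 65
      fits = ℕ.≤-trans (ℕ.+-mono-≤ (ℕ.+-mono-≤ (%13≤12 i) p<25) p<25) (ℕ.m≤m+n 62 3)
    ... | no p≮25 = descend
      (desubstitute leech-decodable {s = s} leechFixed-alternates ℕ.≤-refl (s≤s (ℕ.≮⇒≥ p≮25)) (repeats-cong s-fixed rep))
      where
      descend : ∃[ q ] ∃[ j ] suc p ≡ q * 13 × Repeats s j q q → ⊥
      descend (suc q , j , eq , square) = rec q<p j square
        where
        q<p : q < p
        q<p = s≤s⁻¹ (subst (suc (suc q) ≤_) (sym eq) (ℕ.m<m*n (suc q) 13 (ℕ.m≤m+n 2 11)))

-- Overlaps, curling numbers and exponents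

%22≤21 : ∀ n → n % 22 ≤ 21
%22≤21 n = s≤s⁻¹ (m%n<n n 22)

period≥44 : ∀ {p} → ¬ p < 43 → 44 ≤ suc p
period≥44 p≮43 = s≤s (ℕ.≮⇒≥ p≮43)

ends-in-itself : ∀ (w : InfiniteWord A) i → EndsInPower (factor w 0 (suc i)) 1
ends-in-itself w i = factor w 0 i , w i ∷ [] , (λ ()) , sym (Listₚ.applyUpTo-∷ʳ w i)

-- Subtracting `3 * suc p` leaves `4 * suc p < m * 3`, so `4 * suc p / 3` rounded down is below `m`.
excess-bound : ∀ {p m} → 7 * suc p < (suc p + m) * 3 → excess p ≤ m
excess-bound {p} {m} lt = m<n*o⇒m/o<n
  (ℕ.+-cancelˡ-< (3 * suc p) _ _ (subst₂ _<_ (eq₁ (suc p)) (eq₂ (suc p) m) lt))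
  where
  eq₁ : ∀ p → 7 * p ≡ 3 * p + 4 * p
  eq₁ = solve-∀
  eq₂ : ∀ p m → (p + m) * 3 ≡ 3 * p + m * 3
  eq₂ = solve-∀

-- A rational is stored in lowest terms. Passing to unnormalised fractions restores `n` and `p`, and
-- their order is cross-multiplication.
exponent-bound : ∀ n p .{{_ : NonZero p}} → ((+ 7) ℚ./ 3) ℚ.< ((+ n) ℚ./ p) → 7 * p < n * 3
exponent-bound n p@(suc _) lt = ℤₚ.drop‿+<+ (subst₂ ℤ._<_ (sym (ℤₚ.pos-* 7 p)) (sym (ℤₚ.pos-* n 3))
  (ℚᵘₚ.drop-*<* (ℚᵘₚ.<-respˡ-≃ (ℚₚ.toℚᵘ-fromℚᵘ (ℚᵘ.mkℚᵘ (+ 7) 2))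
    (ℚᵘₚ.<-respʳ-≃ (ℚₚ.toℚᵘ-fromℚᵘ (ℚᵘ.mkℚᵘ (+ n) _)) (ℚₚ.toℚᵘ-mono-< lt)))))

module _ {s : InfiniteWord (Fin 3)} (s-squareFree : SquareFree s) where

  w : InfiniteWord (Fin 3)
  w = image wordMorphism s

  c : InfiniteWord ℕ
  c = image curlingMorphism s

  s-words : ∀ j → SquareFreeWord (factor s j 5)
  s-words = squareFree⇒word s-squareFree

  w-overlap : ∀ i p → ¬ Repeats w i (suc p) (suc (suc p))
  w-overlap i p rep with p <? 43
  ... | yes p<43 = word-short (factor s (i / 22) 5) refl (s-words (i / 22)) (m%n<n i 22) p<43
    fits (window wordMorphism s 5 fits rep)
    where
    fits : i % 22 + suc p + suc (suc p) ≤ 110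
    fits = ℕ.≤-trans (ℕ.+-mono-≤ (ℕ.+-mono-≤ (%22≤21 i) p<43) (s≤s p<43)) (ℕ.m≤m+n 108 2)
  ... | no p≮43 = no-long-square wordMorphism-decodable s-squareFree (ℕ.n≤1+n (suc p)) (ℕ.m≤n⇒m≤1+n (period≥44 p≮43)) rep

  -- Both morphisms have block length 22, so a position in a window of `w` is the same position in
  -- the corresponding window of `c`.
  w-square : ∀ i p → Repeats w i (suc p) (suc p) → c (i + (p + suc p)) ≡ 2
  w-square i p rep with p <? 43
  ... | no p≮43 = ⊥-elim (no-long-square wordMorphism-decodable s-squareFree ℕ.≤-refl (period≥44 p≮43) rep)
  ... | yes p<43 = trans (cong c (sym (ℕ.+-identityʳ e))) (Listₚ.∷-injectiveˡ (begin
      factor c e 1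
        ≡⟨ cong (λ b → factor c b 1) shape ⟩
      factor c (j * 22 + (o + (p + suc p))) 1
        ≡⟨ slice-factor c (j * 22) (o + (p + suc p)) {1} {110} fits₁ ⟨
      slice (o + (p + suc p)) 1 (factor c (j * 22) 110)
        ≡⟨ cong (slice (o + (p + suc p)) 1) (factor-blocks curlingMorphism s j 5) ⟩
      slice (o + (p + suc p)) 1 (imageList curlingMorphism (factor s j 5))
        ≡⟨ word-squares (factor s j 5) refl (s-words j) (m%n<n i 22) p<43 (window wordMorphism s 5 fits rep) ⟩
      2 ∷ [] ∎))
    where
    open ≡-Reasoning
    e = i + (p + suc p)
    j = i / 22
    o = i % 22
    fits : o + suc p + suc p ≤ 110
    fits = ℕ.≤-trans (ℕ.+-mono-≤ (ℕ.+-mono-≤ (%22≤21 i) p<43) p<43) (ℕ.m≤m+n 107 3)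
    fits₁ : o + (p + suc p) + 1 ≤ 110
    fits₁ = subst (_≤ 110) (lemma o p) fits
      where
      lemma : ∀ o p → o + suc p + suc p ≡ o + (p + suc p) + 1
      lemma = solve-∀
    shape : e ≡ j * 22 + (o + (p + suc p))
    shape = trans (cong (_+ (p + suc p)) (index-split i)) (ℕ.+-assoc (j * 22) o (p + suc p))

  w-overlapFree : OverlapFree w
  w-overlapFree (i , u-factor) isOverlap = let p , rep = overlap⇒repeats u-factor isOverlap in w-overlap i p rep

  c-letter : ∀ i → c i ≡ 1 ⊎ c i ≡ 2 × EndsInPower (factor w 0 (suc i)) 2
  c-letter i with curling-letter (s (i / 22)) (i mod 22)
  ... | inj₁ eq = inj₁ eq
  ... | inj₂ (eq , o , p , ends , slices) = inj₂ (eq ,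
        subst (λ n → EndsInPower (factor w 0 n) 2) (sym end)
          (square⇒endsInPower w (slices⇒repeats w (factor-block wordMorphism s j) fits slices)))
    where
    j = i / 22
    fits : toℕ o + suc (toℕ p) + suc (toℕ p) ≤ 22
    fits = subst (_≤ 22) ends (Finₚ.toℕ<n (i mod 22))
    end : suc i ≡ j * 22 + toℕ o + suc (toℕ p) + suc (toℕ p)
    end = trans (cong suc (index-split i)) (trans (sym (ℕ.+-suc (j * 22) (i % 22)))
      (trans (cong (λ r → j * 22 + r) (trans (cong suc (sym (Finₚ.toℕ-fromℕ< (m%n<n i 22)))) ends))
        (lemma (j * 22) (toℕ o) (suc (toℕ p)))))
      where
      lemma : ∀ b o p → b + (o + p + p) ≡ b + o + p + p
      lemma = solve-∀

  c-positive : ∀ i → 1 ≤ c i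
  c-positive i with c-letter i
  ... | inj₁ eq       = ℕ.≤-reflexive (sym eq)
  ... | inj₂ (eq , _) = subst (1 ≤_) (sym eq) (ℕ.m≤m+n 1 1)

  c-greatest : ∀ i {m} → EndsInPower (factor w 0 (suc i)) m → m ≤ c i
  c-greatest i {zero}        _ = z≤n
  c-greatest i {suc zero}    _ = c-positive i
  c-greatest i {suc (suc m)} (_ , []        , z≢[] , _)  = ⊥-elim (z≢[] refl)
  c-greatest i {suc (suc zero)} (y , z@(_ ∷ x) , _ , eq) =
    ℕ.≤-reflexive (sym (trans (cong c end) (w-square (length y) (length x) square)))
    where
    square : Repeats w (length y) (length z) (length z)
    square = factor-shift w y z z eq (trans eq (sym (Listₚ.++-assoc y z (z ^ 1))))
    end : i ≡ length y + (length x + length z)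
    end = ℕ.suc-injective (begin
      suc i                                 ≡⟨ length-factor w 0 (suc i) ⟨
      length (factor w 0 (suc i))           ≡⟨ cong length eq ⟩
      length (y ++ z ++ z ++ [])            ≡⟨ Listₚ.length-++ y ⟩
      length y + length (z ++ z ++ [])      ≡⟨ cong (λ n → length y + n) (Listₚ.length-++ z) ⟩
      length y + (length z + length (z ++ [])) ≡⟨ cong (λ u → length y + (length z + length u)) (Listₚ.++-identityʳ z) ⟩
      length y + suc (length x + length z)  ≡⟨ ℕ.+-suc (length y) _ ⟩
      suc (length y + (length x + length z)) ∎)
      where open ≡-Reasoning
  -- In z z z the prefix z z recurs after `length z` letters; this agreement is longer than the
  -- period, hence an overlap.
  c-greatest i {suc (suc (suc m))} (y , z@(_ ∷ x) , _ , eq) = ⊥-elim (w-overlap (length y + 0) (length x)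
    (repeats-sub w 0 fits
      (factor-shift w y z (z ++ z) (trans eq (cong (y ++_) (sym (Listₚ.++-assoc z z (z ^ suc m)))))
        (trans eq (trans (sym (Listₚ.++-assoc y z (z ^ suc (suc m))))
          (cong ((y ++ z) ++_) (sym (Listₚ.++-assoc z z (z ^ m)))))))))
    where
    fits : suc (length z) ≤ length (z ++ z)
    fits = subst (suc (length z) ≤_) (sym (Listₚ.length-++ z)) (ℕ.+-monoˡ-≤ (length z) (s≤s z≤n))

  c-curling : IsCurlingTransform w c
  c-curling i = record
    { positive = c-positive i
    ; attained = attained
    ; greatest = c-greatest i
    }
    where
    attained : EndsInPower (factor w 0 (suc i)) (c i)
    attained with c-letter i
    ... | inj₁ eq = subst (EndsInPower _) (sym eq) (ends-in-itself w i)
    ... | inj₂ (eq , power) = subst (EndsInPower _) (sym eq) power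

  c-repeats : ∀ i p → ¬ Repeats c i (suc p) (excess p)
  c-repeats i p rep with p <? 32
  ... | yes p<32 = curling-short (factor s (i / 22) 5) refl (s-words (i / 22)) (m%n<n i 22) p<32
    fits (window curlingMorphism s 5 fits rep)
    where
    fits : i % 22 + suc p + excess p ≤ 110
    fits = ℕ.≤-trans (ℕ.+-mono-≤ (ℕ.+-mono-≤ (%22≤21 i) p<32) (s≤s (/-monoˡ-≤ 3 (ℕ.*-monoʳ-≤ 4 p<32)))) (ℕ.m≤m+n 96 14)
  ... | no p≮32 = no-long-square curlingMorphism-decodable s-squareFree
      -- The excess is at least the period, by monotonicity of division from
      -- `3 * suc p ≤ 4 * suc p`.
      (ℕ.m≤n⇒m≤1+n (subst (_≤ 4 * suc p / 3) (m*n/n≡m (suc p) 3)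
        (/-monoˡ-≤ 3 (subst (_≤ 4 * suc p) (ℕ.*-comm 3 (suc p)) (ℕ.*-monoˡ-≤ (suc p) (ℕ.m≤m+n 3 1))))))
      (s≤s (ℕ.≤-trans (ℕ.n≤1+n 43) (/-monoˡ-≤ 3 (ℕ.*-monoʳ-≤ 4 (s≤s (ℕ.≮⇒≥ p≮32)))))) rep

  c-free : ((+ 7) ℚ./ 3) ⁺-Free c
  c-free {u} (i , u-factor) (suc p , nz , least , refl) lt =
    let m , p+m≡n , rep = hasPeriod⇒repeats c i (length u) u-factor (IsLeastPeriod.hasPeriod least)
        7p<3n = exponent-bound (length u) (suc p) {{nz}} lt
        m-large = excess-bound (subst (λ n → 7 * suc p < n * 3) (sym p+m≡n) 7p<3n)
    in c-repeats (i + 0) p (repeats-sub c 0 m-large rep)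

-- The word of the theorem

base : InfiniteWord (Fin 3)
-- `ℕ.m≤m+n 2 11` proves `1 < 13`, and `refl` that the block of 0 begins with 0.
base = FixedPoint.fixedPoint leech (ℕ.m≤m+n 2 11) {0F} refl

base-squareFree : SquareFree base
base-squareFree = leechFixed-squareFree (FixedPoint.fixedPoint-fixed leech (ℕ.m≤m+n 2 11) {0F} refl)

theorem10 : Σ[ w ∈ InfiniteWord (Fin 3) ] OverlapFree w × (Σ[ c ∈ InfiniteWord ℕ ] IsCurlingTransform w c × ((+ 7) ℚ./ 3) ⁺-Free c)
theorem10 = image wordMorphism base , w-overlapFree base-squareFree ,
            image curlingMorphism base , c-curling base-squareFree , c-free base-squareFree
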